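{- There exists a deterministic algorithm that, given positive integers $D<N$, returns in time $O\left(D^{2.5+o(1)}\operatorname{polylog}(N)\right)$ one of the following (the returned output being correct): 1. an element $a\in\mathbb{Z}_N^*$ with $\operatorname{ord}_N(a)>D$; 2. a non-trivial factor of $N$; 3. the statement "$N$ is prime".
   Context: $\mathbb{Z}_N^*$ denotes the multiplicative group of residue classes modulo $N$ that are coprime to $N$. For a positive integer $a$ coprime to $N$, $\operatorname{ord}_N(a)$ is the smallest positive integer $k$ with $a^k\equiv 1 \pmod N$. A non-trivial factor of $N$ is a divisor $d$ of $N$ with $1<d<N$. The output is correct in the sense that an element returned as in 1 does satisfy $\operatorname{ord}_N(a)>D$, an integer returned as in 2 is a non-trivial factor of $N$, and "$N$ is prime" is returned only if $N$ is prime. Running time is worst-case time in a standard deterministic model of computation, in which basic arithmetic on integers modulo $N$ takes time polynomial in $\log N$. The bound $O(D^{2.5+o(1)}\operatorname{polylog}(N))$ means: there are constants $C,c>0$ and a function $\varepsilon(D)\to 0$ as $D\to\infty$, independent of $N$, such that the running time is at most $C\,D^{2.5+\varepsilon(D)}(\log N)^c$ for all positive integers $D<N$. -}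

module Defs where

open import Data.Bool.Base using (if_then_else_)
open import Data.Integer.Base using (ℤ; +_; -[1+_])
open import Data.List.Base using (List; head; drop)
open import Data.Maybe.Base using (Maybe; just; nothing)
open import Data.Nat.Base
open import Data.Nat.Coprimality using (Coprime)
open import Data.Nat.Divisibility using (_∣_)
open import Data.Nat.Logarithm using (⌊log₂_⌋)
open import Data.Nat.Primality using (Prime)
open import Data.Product.Base using (∃; ∃-syntax; _×_)
open import Data.Rational.Base as ℚ using (ℚ; 0ℚ; ↥_; ↧ₙ_)
open import Relation.Binary.PropositionalEquality.Core using (_≡_)

------------------------------------------------------------------------
-- The model of computation: the random access machine of Cook–Reckhow
-- and Aho–Hopcroft–Ullman, with natural-number registers, a fixed
-- program and the logarithmic cost criterion.

data Operand : Set where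
  const  : ℕ → Operand
  reg    : ℕ → Operand
  reg[_] : ℕ → Operand            -- indirect: the register whose index is in the given one

data Target : Set where
  reg    : ℕ → Target
  reg[_] : ℕ → Target

data BinOp : Set where
  add sub mul div : BinOp

data Instruction : Set where
  copy  : Target → Operand → Instruction
  arith : BinOp → Target → Operand → Operand → Instruction
  jump  : ℕ → Instruction
  jzero : Operand → ℕ → Instruction
  halt  : Instruction

Program : Set
Program = List Instruction

Memory : Set
Memory = ℕ → ℕ

record State : Set where
  constructor ⟨_,_⟩
  field
    pc  : ℕ
    mem : Memory

_[_↦_] : Memory → ℕ → ℕ → Memory
(m [ i ↦ v ]) j = if i ≡ᵇ j then v else m j

value : Memory → Operand → ℕ
value m (const n) = n
value m (reg i)   = m i
value m reg[ i ]  = m (m i)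

address : Memory → Target → ℕ
address m (reg i)  = i
address m reg[ i ] = m i

-- Subtraction is truncated, and dividing by 0 yields 0.
apply : BinOp → ℕ → ℕ → ℕ
apply add x y       = x + y
apply sub x y       = x ∸ y
apply mul x y       = x * y
apply div x zero    = 0
apply div x (suc y) = x / suc y

-- The number of binary digits (⌊log₂ 0 ⌋ is 0, so 0 has one digit).
size : ℕ → ℕ
size n = suc ⌊log₂ n ⌋

operandCost : Memory → Operand → ℕ
operandCost m (const n) = size n
operandCost m (reg i)   = size i + size (m i)
operandCost m reg[ i ]  = size i + size (m i) + size (m (m i))

targetCost : Memory → Target → ℕ
targetCost m (reg i)  = size i
targetCost m reg[ i ] = size i + size (m i)

-- Addition and subtraction take linear time in the number of digits;
-- multiplication and division are charged as for the schoolbook methods.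
opCost : BinOp → ℕ → ℕ → ℕ
opCost add x y = size x + size y
opCost sub x y = size x + size y
opCost mul x y = size x * size y
opCost div x y = size x * size y

cost : Instruction → Memory → ℕ
cost (copy t x) m =
  targetCost m t + operandCost m x
cost (arith o t x y) m =
  targetCost m t + operandCost m x + operandCost m y
  + opCost o (value m x) (value m y) + size (apply o (value m x) (value m y))
cost (jump l)    m = 1
cost (jzero x l) m = operandCost m x
cost halt        m = 1

execute : Instruction → State → Maybe State
execute (copy t x) ⟨ pc , m ⟩ =
  just ⟨ suc pc , m [ address m t ↦ value m x ] ⟩
execute (arith o t x y) ⟨ pc , m ⟩ =
  just ⟨ suc pc , m [ address m t ↦ apply o (value m x) (value m y) ] ⟩
execute (jump l) ⟨ pc , m ⟩ = just ⟨ l , m ⟩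
execute (jzero x l) ⟨ pc , m ⟩ =
  just ⟨ (if value m x ≡ᵇ 0 then l else suc pc) , m ⟩
execute halt s = nothing

fetch : Program → ℕ → Maybe Instruction
fetch P pc = head (drop pc P)

-- P ⊢ s ⇓ m′ [ t ]: started in s, the program P halts with memory m′
-- after total cost t.  A machine that leaves the program text, instead
-- of reaching a halt instruction, is stuck and does not halt.
data _⊢_⇓_[_] (P : Program) : State → Memory → ℕ → Set where
  stop : ∀ {pc m i} →
         fetch P pc ≡ just i → execute i ⟨ pc , m ⟩ ≡ nothing →
         P ⊢ ⟨ pc , m ⟩ ⇓ m [ cost i m ]
  step : ∀ {pc m i s m′ t} →
         fetch P pc ≡ just i → execute i ⟨ pc , m ⟩ ≡ just s →
         P ⊢ s ⇓ m′ [ t ] →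
         P ⊢ ⟨ pc , m ⟩ ⇓ m′ [ cost i m + t ]

-- The input (D , N) is in registers 0 and 1; all others contain 0.
initial : ℕ → ℕ → State
initial D N = ⟨ 0 , (λ { 0 → D ; 1 → N ; _ → 0 }) ⟩

data Output : Set where
  element factor : ℕ → Output
  prime          : Output

-- Register 0 holds the kind of the output, register 1 its argument.
output : Memory → Maybe Output
output m with m 0
... | 1 = just (element (m 1))
... | 2 = just (factor (m 1))
... | 3 = just prime
... | _ = nothing

------------------------------------------------------------------------
-- Correctness of outputs

_≡_[mod_] : ℕ → ℕ → ℕ → Set
x ≡ y [mod n ] = n ∣ ∣ x - y ∣

record IsOrder (N a k : ℕ) : Set where
  field
    positive : 0 < k
    power≡1  : (a ^ k) ≡ 1 [mod N ]
    minimal  : ∀ {j} → 0 < j → (a ^ j) ≡ 1 [mod N ] → k ≤ j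

-- Residue classes are given by their representatives below N.
Correct : ℕ → ℕ → Output → Set
Correct D N (element a) = a < N × Coprime a N × (∃[ k ] IsOrder N a k × D < k)
Correct D N (factor d)  = 1 < d × d < N × d ∣ N
Correct D N prime       = Prime N

------------------------------------------------------------------------
-- Running-time bounds

posPart negPart : ℤ → ℕ
posPart (+ n)    = n
posPart -[1+ n ] = 0
negPart (+ n)    = 0
negPart -[1+ n ] = suc n

-- For D > 0 this is t ≤ K · D ^ r: with r = p / q in lowest terms, both
-- sides are raised to the power q and a negative p is moved to the left.
_≤_·_^ℚ_ : ℕ → ℕ → ℕ → ℚ → Set
t ≤ K · D ^ℚ r =
  t ^ (↧ₙ r) * D ^ negPart (↥ r) ≤ K ^ (↧ₙ r) * D ^ posPart (↥ r)

TendsToZero : (ℕ → ℚ) → Set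
TendsToZero ε =
  ∀ δ → 0ℚ ℚ.< δ → ∃[ D₀ ] ∀ D → D₀ ≤ D → ℚ.∣ ε D ∣ ℚ.< δ

-- t ≤ C · D ^ (5/2 + ε D) · (log N) ^ c.  For N ≥ 2 the number ⌊log₂ N ⌋
-- is within constant factors of log N and at least 1, so that natural
-- constants C and c, and rational values of ε, are no restriction: real
-- ones can be rounded up.
WithinBound : (C c : ℕ) (ε : ℕ → ℚ) (D N t : ℕ) → Set
WithinBound C c ε D N t =
  t ≤ (C * ⌊log₂ N ⌋ ^ c) · D ^ℚ ((+ 5 ℚ./ 2) ℚ.+ ε D)

{-# OPTIONS --safe #-}

-- Let s be minimal with s² ≥ D and K = s², so that s ≤ 2 √D.  Trial
-- division up to K² + 1 factors N, proves it prime, or shows that all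
-- positive integers up to K² + 1 are coprime to N.  In the last case
-- 2, 3, … are tried in turn as a: the baby steps a ^ j (j < s) are
-- compared with the giant steps a ^ (s i) (0 < i ≤ s), and if there is no
-- collision then ord a > D.  A collision gives a ^ k ≡ 1 for some
-- 0 < k ≤ K, that is, a root modulo N of the monic polynomial
-- ∏ (X ^ k − 1) of degree at most K².  As differences of small numbers are
-- units modulo N, this polynomial has at most K² roots among
-- 1, …, K² + 1, so the search stops.  The time is O(s⁵) steps, each of
-- them of cost O((log N)²); no ε is needed in the exponent.
module Submission where

open import Defs
open import Data.Bool.Base as Bool using (true; false; if_then_else_)
open import Data.Fin.Base using (Fin; toℕ; fromℕ<)
open import Data.Fin.Properties using (pigeonhole; fromℕ<-injective)
open import Data.Integer.Base as ℤ using (ℤ; +_; 0ℤ; 1ℤ; -1ℤ)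
import Data.Integer.Divisibility.Signed as Signed
import Data.Integer.Properties as ℤ
import Data.Integer.Solver as ℤ
open import Data.List.Base using (List; []; _∷_; length; replicate)
open import Data.List.Properties using (length-replicate)
open import Data.List.Relation.Unary.All as All using (All; _∷_)
open import Data.Maybe.Base using (just)
open import Data.Nat.Base
open import Data.Nat.Coprimality as Coprime using (Coprime; coprime-divisor)
open import Data.Nat.Divisibility hiding (quotient)
open import Data.Nat.DivMod hiding (_div_; result)
open import Data.Nat.Logarithm using (⌊log₂_⌋; ⌊log₂⌋-mono-≤; ⌊log₂[2^n]⌋≡n)
open import Data.Nat.Primality using (Prime; prime; composite)
open import Data.Nat.Properties
open import Data.Nat.Solver using (module +-*-Solver)
open import Data.Product.Base using (∃-syntax; _×_; _,_; proj₁; proj₂)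
open import Data.Rational.Base using (0ℚ)
open import Data.Sum.Base using (_⊎_; inj₁; inj₂)
open import Function.Base using (_∘_)
open import Relation.Binary.PropositionalEquality
open import Relation.Nullary using (¬_; Dec; yes; no; contradiction)
open import Relation.Nullary.Decidable using (from-yes)
open import Relation.Unary using (Decidable)

-- Running programs under a bound on the register contents

size-mono-≤ : ∀ {x y} → x ≤ y → size x ≤ size y
size-mono-≤ x≤y = s≤s (⌊log₂⌋-mono-≤ x≤y)

value-cong : ∀ {m m′} → m ≗ m′ → ∀ x → value m x ≡ value m′ x
value-cong e (const n) = refl
value-cong e (reg i)   = e i
value-cong {m} {m′} e reg[ i ] = trans (e (m i)) (cong m′ (e i))

address-cong : ∀ {m m′} → m ≗ m′ → ∀ t → address m t ≡ address m′ t
address-cong e (reg i)  = refl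
address-cong e reg[ i ] = e i

update-cong : ∀ {m m′ i i′ v v′} → m ≗ m′ → i ≡ i′ → v ≡ v′ →
              m [ i ↦ v ] ≗ m′ [ i′ ↦ v′ ]
update-cong {i = i} e refl refl j with i ≡ᵇ j
... | true  = refl
... | false = e j

operandLiteral : Operand → ℕ
operandLiteral (const n) = n
operandLiteral (reg i)   = i
operandLiteral reg[ i ]  = i

targetLiteral : Target → ℕ
targetLiteral (reg i)  = i
targetLiteral reg[ i ] = i

largestLiteral : Instruction → ℕ
largestLiteral (copy t x)      = targetLiteral t ⊔ operandLiteral x
largestLiteral (arith o t x y) = targetLiteral t ⊔ (operandLiteral x ⊔ operandLiteral y)
largestLiteral (jump l)        = 0
largestLiteral (jzero x l)     = operandLiteral x
largestLiteral halt            = 0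

fetch-All : ∀ {Q : Instruction → Set} {P} → All Q P →
            ∀ pc {i} → fetch P pc ≡ just i → Q i
fetch-All (q ∷ _)  zero     refl = q
fetch-All (_ ∷ qs) (suc pc) eq   = fetch-All qs pc eq

BoundedBy : ℕ → Memory → Set
BoundedBy B m = ∀ i → m i ≤ B

update-bounded : ∀ {B m v} i → BoundedBy B m → v ≤ B → BoundedBy B (m [ i ↦ v ])
update-bounded i b v≤B j with i ≡ᵇ j
... | true  = v≤B
... | false = b j

-- `arith` is the dearest instruction: 2 + 3 + 3 sizes for the target and the operands, at most 2
-- sizes and a squared size for the operation, and 1 for the result.
stepCost : ℕ → ℕ
stepCost B = 11 * size B + size B * size B

module _ {B : ℕ} {m : Memory} (b : BoundedBy B m) where

  private
    S = size B

  value-≤ : ∀ x → operandLiteral x ≤ B → value m x ≤ B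
  value-≤ (const n) l = l
  value-≤ (reg i)   l = b i
  value-≤ reg[ i ]  l = b (m i)

  operandCost-≤ : ∀ x → operandLiteral x ≤ B → operandCost m x ≤ 3 * S
  operandCost-≤ (const n) l = ≤-trans (size-mono-≤ l) (m≤m+n S _)
  operandCost-≤ (reg i)   l =
    +-mono-≤ (size-mono-≤ l) (≤-trans (size-mono-≤ (b i)) (m≤m+n S _))
  operandCost-≤ reg[ i ]  l = ≤-trans
    (≤-reflexive (+-assoc (size i) _ _))
    (+-mono-≤ (size-mono-≤ l)
      (+-mono-≤ (size-mono-≤ (b i)) (≤-trans (size-mono-≤ (b (m i))) (m≤m+n S _))))

  targetCost-≤ : ∀ t → targetLiteral t ≤ B → targetCost m t ≤ 2 * S
  targetCost-≤ (reg i)  l = ≤-trans (size-mono-≤ l) (m≤m+n S _)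
  targetCost-≤ reg[ i ] l =
    +-mono-≤ (size-mono-≤ l) (≤-trans (size-mono-≤ (b i)) (m≤m+n S _))

  opCost-≤ : ∀ o {x y} → x ≤ B → y ≤ B → opCost o x y ≤ 2 * S + S * S
  opCost-≤ add x≤B y≤B = ≤-trans
    (+-mono-≤ (size-mono-≤ x≤B) (≤-trans (size-mono-≤ y≤B) (m≤m+n S 0))) (m≤m+n _ _)
  opCost-≤ sub x≤B y≤B = opCost-≤ add x≤B y≤B
  opCost-≤ mul x≤B y≤B = ≤-trans (*-mono-≤ (size-mono-≤ x≤B) (size-mono-≤ y≤B)) (m≤n+m (S * S) (2 * S))
  opCost-≤ div x≤B y≤B = opCost-≤ mul x≤B y≤B

  private
    coefficient-≤ : ∀ {n} k → k ≤ 11 → n ≤ k * S → n ≤ stepCost B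
    coefficient-≤ k k≤11 n≤kS =
      ≤-trans n≤kS (≤-trans (*-monoˡ-≤ S k≤11) (m≤m+n (11 * S) (S * S)))

    S≥1 : 1 ≤ 1 * S
    S≥1 = s≤s z≤n

  copyCost-≤ : ∀ t x → largestLiteral (copy t x) ≤ B → cost (copy t x) m ≤ stepCost B
  copyCost-≤ t x l = coefficient-≤ 5 (m≤m+n 5 6)
    (≤-trans
      (+-mono-≤ (targetCost-≤ t (≤-trans (m≤m⊔n _ _) l))
                (operandCost-≤ x (≤-trans (m≤n⊔m _ _) l)))
      (≤-reflexive (sym (*-distribʳ-+ S 2 3))))

  arithCost-≤ : ∀ o t x y → largestLiteral (arith o t x y) ≤ B →
                apply o (value m x) (value m y) ≤ B → cost (arith o t x y) m ≤ stepCost B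
  arithCost-≤ o t x y l r = ≤-trans
    (+-mono-≤ (+-mono-≤ (+-mono-≤ (+-mono-≤
      (targetCost-≤ t (≤-trans (m≤m⊔n _ _) l))
      (operandCost-≤ x lx)) (operandCost-≤ y ly))
      (opCost-≤ o (value-≤ x lx) (value-≤ y ly)))
      (size-mono-≤ r))
    (≤-reflexive (solve 1 (λ s →
      con 2 :* s :+ con 3 :* s :+ con 3 :* s :+ (con 2 :* s :+ s :* s) :+ s
        := con 11 :* s :+ s :* s) refl S))
    where
    open +-*-Solver
    lxy = ≤-trans (m≤n⊔m (targetLiteral t) _) l
    lx  = ≤-trans (m≤m⊔n _ _) lxy
    ly  = ≤-trans (m≤n⊔m (operandLiteral x) _) lxy

  jzeroCost-≤ : ∀ x l → operandLiteral x ≤ B → cost (jzero x l) m ≤ stepCost B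
  jzeroCost-≤ x _ l = coefficient-≤ 3 (m≤m+n 3 8) (operandCost-≤ x l)

  unitCost-≤ : 1 ≤ stepCost B
  unitCost-≤ = coefficient-≤ 1 (m≤m+n 1 10) S≥1

-- Step-counted execution rules for single instructions

module Execution (P : Program) (B : ℕ) (literals : All (λ i → largestLiteral i ≤ B) P)
                 (Good : Output → Set) where

  -- Every instruction is charged the flat rate `stepCost B`, so a time bound reduces to a bound `n`
  -- on the number of instructions.
  record Halts (n : ℕ) (s : State) : Set where
    field
      {result}  : Memory
      {time}    : ℕ
      {verdict} : Output
      halts     : P ⊢ s ⇓ result [ time ]
      outputs   : output result ≡ just verdict
      good      : Good verdict
      time-≤    : time ≤ n * stepCost B

  -- Memories are functions, so the claim is made for all pointwise equal
  -- ones; this makes Run invariant under ≗ without extensionality.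
  record Run (n pc : ℕ) (m : Memory) : Set where
    field
      run : ∀ {m′} → m′ ≗ m → BoundedBy B m′ → Halts n ⟨ pc , m′ ⟩

  open Halts
  open Run

  run-cong : ∀ {n pc m m′} → m ≗ m′ → Run n pc m′ → Run n pc m
  run-cong e r .run e′ = run r (λ i → trans (e′ i) (e i))

  run-mono : ∀ {n n′ pc m} → n ≤ n′ → Run n pc m → Run n′ pc m
  run-mono n≤n′ r .run e b = record
    { halts = halts h ; outputs = outputs h ; good = good h
    ; time-≤ = ≤-trans (time-≤ h) (*-monoˡ-≤ (stepCost B) n≤n′) }
    where h = run r e b

  private
    halts-step : ∀ {n pc i m s} → fetch P pc ≡ just i → execute i ⟨ pc , m ⟩ ≡ just s →
      cost i m ≤ stepCost B → Halts n s → Halts (suc n) ⟨ pc , m ⟩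
    halts-step f e c h = record
      { halts = step f e (halts h) ; outputs = outputs h ; good = good h
      ; time-≤ = +-mono-≤ c (time-≤ h) }

  run-copy : ∀ {n pc m t x} → fetch P pc ≡ just (copy t x) →
    Run n (suc pc) (m [ address m t ↦ value m x ]) → Run (suc n) pc m
  run-copy {pc = pc} {t = t} {x} f r .run {m′} e b =
    halts-step f refl (copyCost-≤ b t x l)
      (run r (update-cong e (address-cong e t) (value-cong e x))
         (update-bounded (address m′ t) b (value-≤ b x (≤-trans (m≤n⊔m _ _) l))))
    where l = fetch-All literals pc f

  run-arith : ∀ {n pc m o t x y} → fetch P pc ≡ just (arith o t x y) →
    apply o (value m x) (value m y) ≤ B →
    Run n (suc pc) (m [ address m t ↦ apply o (value m x) (value m y) ]) → Run (suc n) pc m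
  run-arith {pc = pc} {o = o} {t} {x} {y} f v≤B r .run {m′} e b =
    halts-step f refl (arithCost-≤ b o t x y (fetch-All literals pc f) v′≤B)
      (run r (update-cong e (address-cong e t) same) (update-bounded (address m′ t) b v′≤B))
    where
    same = cong₂ (apply o) (value-cong e x) (value-cong e y)
    v′≤B = ≤-trans (≤-reflexive same) v≤B

  private
    -- Subtraction and division never exceed their first operand, so the result inherits the bound
    -- `B`, for which `run-arith` asks a proof.
    run-decrease : ∀ {n pc m o t x y} → (∀ u v → apply o u v ≤ u) →
      fetch P pc ≡ just (arith o t x y) →
      Run n (suc pc) (m [ address m t ↦ apply o (value m x) (value m y) ]) → Run (suc n) pc m
    run-decrease {pc = pc} {o = o} {t} {x} {y} d f r .run {m′} e b =
      halts-step f refl (arithCost-≤ b o t x y l v′≤B)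
        (run r (update-cong e (address-cong e t) (cong₂ (apply o) (value-cong e x) (value-cong e y)))
           (update-bounded (address m′ t) b v′≤B))
      where
      l = fetch-All literals pc f
      v′≤B = ≤-trans (d (value m′ x) (value m′ y))
        (value-≤ b x (≤-trans (m≤m⊔n _ _) (≤-trans (m≤n⊔m (targetLiteral t) _) l)))

  run-sub : ∀ {n pc m t x y} → fetch P pc ≡ just (arith sub t x y) →
    Run n (suc pc) (m [ address m t ↦ value m x ∸ value m y ]) → Run (suc n) pc m
  run-sub = run-decrease {o = sub} m∸n≤m

  run-div : ∀ {n pc m t x y} → fetch P pc ≡ just (arith div t x y) →
    Run n (suc pc) (m [ address m t ↦ apply div (value m x) (value m y) ]) → Run (suc n) pc m
  run-div = run-decrease {o = div} λ { u zero → z≤n ; u (suc v) → m/n≤m u (suc v) }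

  run-jump : ∀ {n pc m l} → fetch P pc ≡ just (jump l) → Run n l m → Run (suc n) pc m
  run-jump f r .run e b = halts-step f refl (unitCost-≤ b) (run r e b)

  run-jzero-taken : ∀ {n pc m x l} → fetch P pc ≡ just (jzero x l) → value m x ≡ 0 →
    Run n l m → Run (suc n) pc m
  run-jzero-taken {pc = pc} {x = x} {l} f z r .run {m′} e b =
    halts-step f (cong (λ v → just ⟨ (if v ≡ᵇ 0 then l else suc pc) , m′ ⟩)
                 (trans (value-cong e x) z))
      (jzeroCost-≤ b x l (fetch-All literals pc f)) (run r e b)

  run-jzero-skipped : ∀ {n pc m x l} → fetch P pc ≡ just (jzero x l) → 0 < value m x →
    Run n (suc pc) m → Run (suc n) pc m
  run-jzero-skipped {pc = pc} {m} {x} {l} f p r .run {m′} e b =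
    halts-step f (skip (≤-trans p (≤-reflexive (sym (value-cong e x)))))
      (jzeroCost-≤ b x l (fetch-All literals pc f)) (run r e b)
    where
    skip : ∀ {v} → 0 < v →
      just ⟨ (if v ≡ᵇ 0 then l else suc pc) , m′ ⟩ ≡ just ⟨ suc pc , m′ ⟩
    skip (s≤s _) = refl

  run-halt : ∀ {n pc m o} → fetch P pc ≡ just halt →
    (∀ {m′} → m′ ≗ m → output m′ ≡ just o) → Good o → Run (suc n) pc m
  run-halt {n} f out g .run e b = record
    { halts = stop f refl ; outputs = out e ; good = g
    ; time-≤ = ≤-trans (unitCost-≤ b) (m≤m+n (stepCost B) (n * stepCost B)) }

output-element : ∀ {m} → m 0 ≡ 1 → output m ≡ just (element (m 1))
output-element {m} eq with m 0 | eq
... | .1 | refl = refl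

output-factor : ∀ {m} → m 0 ≡ 2 → output m ≡ just (factor (m 1))
output-factor {m} eq with m 0 | eq
... | .2 | refl = refl

output-prime : ∀ {m} → m 0 ≡ 3 → output m ≡ just prime
output-prime {m} eq with m 0 | eq
... | .3 | refl = refl

-- Orders modulo N

least : ∀ {P : ℕ → Set} → Decidable P → ∀ w → P w →
        ∃[ n ] P n × (∀ {j} → j < n → ¬ P j)
least P? zero    p = 0 , p , λ ()
least P? (suc w) p with P? 0
... | yes p₀ = 0 , p₀ , λ ()
... | no ¬p₀ with least (P? ∘ suc) w p
...   | n , q , below = suc n , q , λ { {zero} _ → ¬p₀ ; {suc j} (s≤s j<n) → below j<n }

%≡⇒≡mod : ∀ {x y N} .{{_ : NonZero N}} → x % N ≡ y % N → x ≡ y [mod N ]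
%≡⇒≡mod {x} {y} {N} eq = divides ∣ x / N - y / N ∣ (begin
  ∣ x - y ∣                                  ≡⟨ cong₂ ∣_-_∣ (m≡m%n+[m/n]*n x N) (m≡m%n+[m/n]*n y N) ⟩
  ∣ x % N + x / N * N - y % N + y / N * N ∣  ≡⟨ cong (λ r → ∣ r + x / N * N - y % N + y / N * N ∣) eq ⟩
  ∣ y % N + x / N * N - y % N + y / N * N ∣  ≡⟨ ∣m+n-m+o∣≡∣n-o∣ (y % N) _ _ ⟩
  ∣ x / N * N - y / N * N ∣                  ≡⟨ *-distribʳ-∣-∣ N (x / N) (y / N) ⟨
  ∣ x / N - y / N ∣ * N                      ∎)
  where open ≡-Reasoning

≤-≡mod⇒%≡ : ∀ {x y N} .{{_ : NonZero N}} → x ≤ y → N ∣ y ∸ x → x % N ≡ y % N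
≤-≡mod⇒%≡ {x} {y} {N} x≤y d =
  trans (sym (%-remove-+ʳ x d)) (cong (_% N) (m+[n∸m]≡n x≤y))

≡mod⇒%≡ : ∀ {x y N} .{{_ : NonZero N}} → x ≡ y [mod N ] → x % N ≡ y % N
≡mod⇒%≡ {x} {y} {N} d with ≤-total x y
... | inj₁ x≤y = ≤-≡mod⇒%≡ x≤y (subst (N ∣_) (m≤n⇒∣m-n∣≡n∸m x≤y) d)
... | inj₂ y≤x = sym (≤-≡mod⇒%≡ y≤x (subst (N ∣_) (m≤n⇒∣n-m∣≡n∸m y≤x) d))

*%-congˡ : ∀ {x y} z {N} .{{_ : NonZero N}} → x % N ≡ y % N → x * z % N ≡ y * z % N
*%-congˡ {x} {y} z {N} eq = trans (%-distribˡ-* x z N)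
  (trans (cong (λ r → r * (z % N) % N) eq) (sym (%-distribˡ-* y z N)))

[m%n*o]%n≡m*o%n : ∀ m o n .{{_ : NonZero n}} → m % n * o % n ≡ m * o % n
[m%n*o]%n≡m*o%n m o n = *%-congˡ o (m%n%n≡m%n m n)

coprime-power-divisor : ∀ {N a z} → Coprime N a → ∀ j → N ∣ a ^ j * z → N ∣ z
coprime-power-divisor {N} {a} {z} c zero    d = subst (N ∣_) (*-identityˡ z) d
coprime-power-divisor {N} {a} {z} c (suc j) d =
  coprime-power-divisor c j (coprime-divisor c (subst (N ∣_) (*-assoc a (a ^ j) z) d))

-- The unit `a ^ j` cancels from `N ∣ a ^ j * ∣ a ^ k - 1 ∣`. This turns collisions between powers
-- into relations `a ^ k ≡ 1`.
power-cancel : ∀ {N a} .{{_ : NonZero N}} → Coprime N a → ∀ j k →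
               a ^ (j + k) % N ≡ a ^ j % N → (a ^ k) ≡ 1 [mod N ]
power-cancel {N} {a} c j k eq = coprime-power-divisor c j (subst (N ∣_) (begin
  ∣ a ^ (j + k) - a ^ j ∣        ≡⟨ cong₂ ∣_-_∣ (^-distribˡ-+-* a j k) (sym (*-identityʳ (a ^ j))) ⟩
  ∣ a ^ j * a ^ k - a ^ j * 1 ∣  ≡⟨ *-distribˡ-∣-∣ (a ^ j) (a ^ k) 1 ⟨
  a ^ j * ∣ a ^ k - 1 ∣          ∎) (%≡⇒≡mod eq))
  where open ≡-Reasoning

power-shift : ∀ {N a} .{{_ : NonZero N}} → ∀ j k → (a ^ k) ≡ 1 [mod N ] →
              a ^ (j + k) % N ≡ a ^ j % N
power-shift {N} {a} j k d = begin
  a ^ (j + k) % N    ≡⟨ cong (λ e → a ^ e % N) (+-comm j k) ⟩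
  a ^ (k + j) % N    ≡⟨ cong (_% N) (^-distribˡ-+-* a k j) ⟩
  a ^ k * a ^ j % N  ≡⟨ *%-congˡ {a ^ k} (a ^ j) (≡mod⇒%≡ d) ⟩
  1 * a ^ j % N      ≡⟨ cong (_% N) (*-identityˡ (a ^ j)) ⟩
  a ^ j % N          ∎
  where open ≡-Reasoning

-- Two of the powers with exponents `0, …, N` agree modulo `N` by the pigeonhole principle;
-- cancelling gives a positive exponent, from which the least one is found.
order-exists : ∀ {N a} .{{_ : NonZero N}} → Coprime N a → ∃[ k ] IsOrder N a k
order-exists {N} {a} c
  with i , j , i<j , eq ← pigeonhole (n<1+n N) (λ (i : Fin (suc N)) → fromℕ< (m%n<n (a ^ toℕ i) N))
  -- The search runs over exponents `suc k`, which confines the minimum to positive ones.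
  with k , p , below ← least (λ k → N ∣? ∣ a ^ suc k - 1 ∣) (toℕ j ∸ suc (toℕ i))
         (power-cancel c (toℕ i) _ (trans (cong (λ e → a ^ e % N)
             (trans (+-suc (toℕ i) _) (m+[n∸m]≡n i<j)))
           (sym (fromℕ<-injective _ _ _ _ eq))))
  = suc k , record
  { positive = z<s
  ; power≡1  = p
  ; minimal  = λ { {suc j} _ q → ≮⇒≥ λ { (s≤s j<k) → below j<k q } } }

-- Roots of monic polynomials

-- A list of coefficients stands for a monic polynomial, lowest degree
-- first, with the leading coefficient left out.
Monic : Set
Monic = List ℤ

eval : Monic → ℤ → ℤ
eval []      x = 1ℤ
eval (c ∷ p) x = c ℤ.+ x ℤ.* eval p x

-- The quotient of `p - p(r)` by `X - r`: its coefficients are the Horner values at `r` of the tails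
-- of `p`, the leading one being again an omitted 1. The value at `[]` is a default.
quotient : ℤ → Monic → Monic
quotient r []          = []
quotient r (c ∷ [])    = []
quotient r (c ∷ d ∷ p) = eval (d ∷ p) r ∷ quotient r (d ∷ p)

length-quotient : ∀ r c p → length (quotient r (c ∷ p)) ≡ length p
length-quotient r c []      = refl
length-quotient r c (d ∷ p) = cong suc (length-quotient r d p)

eval-quotient : ∀ r x c p → eval (c ∷ p) x ℤ.- eval (c ∷ p) r
                            ≡ (x ℤ.- r) ℤ.* eval (quotient r (c ∷ p)) x
eval-quotient r x c [] =
  solve 3 (λ x r c → (c :+ x :* con 1ℤ) :- (c :+ r :* con 1ℤ) := (x :- r) :* con 1ℤ) refl x r c
  where open ℤ.+-*-Solver
eval-quotient r x c p@(d ∷ p′) = begin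
  (c ℤ.+ x ℤ.* eval p x) ℤ.- (c ℤ.+ r ℤ.* eval p r)
    ≡⟨ solve 5 (λ x r c u v → (c :+ x :* u) :- (c :+ r :* v)
                   := x :* (u :- v) :+ (x :- r) :* v) refl x r c (eval p x) (eval p r) ⟩
  x ℤ.* (eval p x ℤ.- eval p r) ℤ.+ (x ℤ.- r) ℤ.* eval p r
    ≡⟨ cong (λ w → x ℤ.* w ℤ.+ (x ℤ.- r) ℤ.* eval p r) (eval-quotient r x d p′) ⟩
  x ℤ.* ((x ℤ.- r) ℤ.* q) ℤ.+ (x ℤ.- r) ℤ.* eval p r
    ≡⟨ solve 4 (λ x r q v → x :* ((x :- r) :* q) :+ (x :- r) :* v
                   := (x :- r) :* (v :+ x :* q)) refl x r q (eval p r) ⟩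
  (x ℤ.- r) ℤ.* (eval p r ℤ.+ x ℤ.* q) ∎
  where
  open ≡-Reasoning
  open ℤ.+-*-Solver
  q = eval (quotient r p) x

-- Consecutive roots suffice here, and the prime modulus of Lagrange's
-- theorem is replaced by one coprime to all differences of the roots.
monic-roots : ∀ {N} d p → length p ≡ d → (∀ t → 0 < t → t ≤ d → Coprime N t) →
  (∀ x → 0 < x → x ≤ suc d → N ∣ ℤ.∣ eval p (+ x) ∣) → N ∣ 1
-- In degree 0 the polynomial is 1, and its root at 1 already says `N ∣ 1`.
monic-roots zero    []      len c root = root 1 z<s ≤-refl
monic-roots {N} (suc d) (k ∷ p) len c root =
  monic-roots d (quotient (+ r) (k ∷ p)) (trans (length-quotient (+ r) k p) (suc-injective len))
    (λ t 0<t t≤d → c t 0<t (m≤n⇒m≤1+n t≤d)) quotient-root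
  where
  r = suc (suc d)
  quotient-root : ∀ x → 0 < x → x ≤ suc d → N ∣ ℤ.∣ eval (quotient (+ r) (k ∷ p)) (+ x) ∣
  -- Splitting off the largest root `r` leaves `N ∣ (r - x) * q`; as `0 < r - x ≤ d + 1`, the first
  -- factor is coprime to `N`.
  quotient-root x 0<x x≤1+d = coprime-divisor
    (c (r ∸ x) (m<n⇒0<n∸m (s≤s x≤1+d)) (∸-monoʳ-≤ r 0<x))
    (subst (N ∣_) (begin
      ℤ.∣ eval (k ∷ p) (+ x) ℤ.- eval (k ∷ p) (+ r) ∣
        ≡⟨ cong ℤ.∣_∣ (eval-quotient (+ r) (+ x) k p) ⟩
      ℤ.∣ (+ x ℤ.- + r) ℤ.* q ∣
        ≡⟨ ℤ.abs-* (+ x ℤ.- + r) q ⟩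
      ℤ.∣ + x ℤ.- + r ∣ * ℤ.∣ q ∣
        ≡⟨ cong (_* ℤ.∣ q ∣) (trans (cong ℤ.∣_∣ (ℤ.[+m]-[+n]≡m⊖n x r)) (ℤ.∣⊖∣-≤ (m≤n⇒m≤1+n x≤1+d))) ⟩
      (r ∸ x) * ℤ.∣ q ∣ ∎)
    (Signed.∣⇒∣ᵤ (Signed.∣m∣n⇒∣m-n {+ N} {eval (k ∷ p) (+ x)} {eval (k ∷ p) (+ r)}
      (Signed.∣ᵤ⇒∣ {+ N} (root x 0<x (m≤n⇒m≤1+n x≤1+d)))
      (Signed.∣ᵤ⇒∣ {+ N} (root r z<s ≤-refl)))))
    where
    open ≡-Reasoning
    q = eval (quotient (+ r) (k ∷ p)) (+ x)

-- Junk unless the second polynomial has smaller degree.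
addScaled : ℤ → Monic → Monic → Monic
addScaled c p       []      = []
addScaled c []      (b ∷ q) = (b ℤ.+ c) ∷ q
addScaled c (a ∷ p) (b ∷ q) = (b ℤ.+ c ℤ.* a) ∷ addScaled c p q

length-addScaled : ∀ c p q → length (addScaled c p q) ≡ length q
length-addScaled c p       []      = refl
length-addScaled c []      (b ∷ q) = refl
length-addScaled c (a ∷ p) (b ∷ q) = cong suc (length-addScaled c p q)

eval-addScaled : ∀ c p q x → length p < length q →
                 eval (addScaled c p q) x ≡ eval q x ℤ.+ c ℤ.* eval p x
eval-addScaled c []      (b ∷ q) x l =
  solve 3 (λ b c w → b :+ c :+ w := b :+ w :+ c :* con 1ℤ) refl b c (x ℤ.* eval q x)
  where open ℤ.+-*-Solver
eval-addScaled c (a ∷ p) (b ∷ q) x (s≤s l) = trans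
  (cong (λ w → b ℤ.+ c ℤ.* a ℤ.+ x ℤ.* w) (eval-addScaled c p q x l))
  (solve 6 (λ a b c x u v → b :+ c :* a :+ x :* (v :+ c :* u)
              := b :+ x :* v :+ c :* (a :+ x :* u)) refl a b c x (eval p x) (eval q x))
  where open ℤ.+-*-Solver

infixl 7 _⊛_

-- Horner's scheme `(c + X p) q = X (p q) + c q`. The first summand has larger degree than `q`, as
-- `addScaled` requires.
_⊛_ : Monic → Monic → Monic
[]      ⊛ q = q
(c ∷ p) ⊛ q = addScaled c q (0ℤ ∷ p ⊛ q)

length-⊛ : ∀ p q → length (p ⊛ q) ≡ length p + length q
length-⊛ []      q = refl
length-⊛ (c ∷ p) q = trans (length-addScaled c q (0ℤ ∷ p ⊛ q)) (cong suc (length-⊛ p q))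

eval-⊛ : ∀ p q x → eval (p ⊛ q) x ≡ eval p x ℤ.* eval q x
eval-⊛ []      q x = sym (ℤ.*-identityˡ _)
eval-⊛ (c ∷ p) q x = trans
  (eval-addScaled c q (0ℤ ∷ p ⊛ q) x
    (s≤s (≤-trans (m≤n+m _ (length p)) (≤-reflexive (sym (length-⊛ p q))))))
  (trans (cong (λ w → 0ℤ ℤ.+ x ℤ.* w ℤ.+ c ℤ.* eval q x) (eval-⊛ p q x))
    (solve 4 (λ c x u v → con 0ℤ :+ x :* (u :* v) :+ c :* v := (c :+ x :* u) :* v)
      refl c x (eval p x) (eval q x)))
  where open ℤ.+-*-Solver

-- X ^ (1 + k) − 1
rootsOfUnity : ℕ → Monic
rootsOfUnity k = -1ℤ ∷ replicate k 0ℤ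

eval-replicate : ∀ k x → eval (replicate k 0ℤ) (+ x) ≡ + (x ^ k)
eval-replicate zero    x = refl
eval-replicate (suc k) x = trans (ℤ.+-identityˡ _)
  (trans (cong (+ x ℤ.*_) (eval-replicate k x)) (sym (ℤ.pos-* x (x ^ k))))

-- The product of X ^ k − 1 for 0 < k ≤ K.
bounded-orders : ℕ → Monic
bounded-orders zero    = []
bounded-orders (suc k) = rootsOfUnity k ⊛ bounded-orders k

-- The degree is `1 + … + K`, estimated crudely.
length-bounded-orders : ∀ K → length (bounded-orders K) ≤ K * K
length-bounded-orders zero    = z≤n
length-bounded-orders (suc K) = ≤-trans
  (≤-reflexive (trans (length-⊛ (rootsOfUnity K) (bounded-orders K))
    (cong (λ l → suc (l + length (bounded-orders K))) (length-replicate K))))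
  (s≤s (+-monoʳ-≤ K (≤-trans (length-bounded-orders K) (*-monoʳ-≤ K (n≤1+n K)))))

root-of-one : ∀ {N x k} → (x ^ suc k) ≡ 1 [mod N ] → N ∣ ℤ.∣ eval (rootsOfUnity k) (+ x) ∣
root-of-one {N} {x} {k} d = subst (N ∣_) (sym (trans
  (cong (λ w → ℤ.∣ -1ℤ ℤ.+ w ∣)
    (trans (cong (+ x ℤ.*_) (eval-replicate k x)) (sym (ℤ.pos-* x (x ^ k)))))
  (abs-pred (x ^ suc k)))) d
  where
  abs-pred : ∀ y → ℤ.∣ -1ℤ ℤ.+ + y ∣ ≡ ∣ y - 1 ∣
  abs-pred zero          = refl
  abs-pred (suc zero)    = refl
  abs-pred (suc (suc y)) = refl

bounded-orders-root : ∀ {N x k} K → 0 < k → k ≤ K → (x ^ k) ≡ 1 [mod N ] →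
                      N ∣ ℤ.∣ eval (bounded-orders K) (+ x) ∣
bounded-orders-root zero (s≤s _) ()
bounded-orders-root {N} {x} {k} (suc K) 0<k k≤K d = subst (N ∣_)
  (sym (trans (cong ℤ.∣_∣ (eval-⊛ (rootsOfUnity K) (bounded-orders K) (+ x)))
              (ℤ.abs-* (eval (rootsOfUnity K) (+ x)) _)))
  divides-factor
  where
  divides-factor : N ∣ ℤ.∣ eval (rootsOfUnity K) (+ x) ∣ * ℤ.∣ eval (bounded-orders K) (+ x) ∣
  divides-factor with m≤n⇒m<n∨m≡n k≤K
  ... | inj₁ (s≤s k≤K′) = ∣n⇒∣m*n ℤ.∣ eval (rootsOfUnity K) (+ x) ∣ (bounded-orders-root K 0<k k≤K′ d)
  ... | inj₂ refl       = ∣m⇒∣m*n _ (root-of-one {N} {x} {K} d)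

-- The contradiction that ends the search: a monic polynomial vanishing at one point more than its
-- degree would make `N` divide 1.
not-all-orders-bounded : ∀ {N} K → 1 < N → (∀ t → 0 < t → t ≤ K * K → Coprime N t) →
  ¬ (∀ x → 0 < x → x ≤ suc (K * K) → ∃[ k ] 0 < k × k ≤ K × (x ^ k) ≡ 1 [mod N ])
not-all-orders-bounded {N} K 1<N c orders = <⇒≱ 1<N (∣⇒≤ (monic-roots _ (bounded-orders K) refl
  (λ t 0<t t≤d → c t 0<t (≤-trans t≤d (length-bounded-orders K)))
  λ x 0<x x≤1+d →
    let k , 0<k , k≤K , d = orders x 0<x (≤-trans x≤1+d (s≤s (length-bounded-orders K)))
    in bounded-orders-root K 0<k k≤K d))

-- The program

-- Registers: 0 = D, 1 = N, 2 = s with s * s ≥ D, 3 = the trial bound,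
-- 4 = the trial divisor and later the base a, 5 = the current power of
-- a, 6 = the loop counter, 7 = scratch, 8 = a ^ s.  From 9 on there is a
-- table indexed by residues; it is never cleared, since a residue counts
-- as a power of a only if its entry is a.
program : Program
program =
    arith add (reg 2) (reg 2) (const 1)
  ∷ arith mul (reg 7) (reg 2) (reg 2)
  ∷ arith sub (reg 7) (reg 0) (reg 7)
  ∷ jzero (reg 7) 5
  ∷ jump 0
  -- 5: s has been found
  ∷ arith mul (reg 3) (reg 2) (reg 2)
  ∷ arith mul (reg 3) (reg 3) (reg 3)
  ∷ arith add (reg 3) (reg 3) (const 2)
  ∷ copy (reg 4) (const 2)
  -- 9: trial division
  ∷ arith sub (reg 7) (reg 3) (reg 4)
  ∷ jzero (reg 7) 24
  ∷ arith div (reg 7) (reg 1) (reg 4)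
  ∷ arith mul (reg 7) (reg 7) (reg 4)
  ∷ arith sub (reg 7) (reg 1) (reg 7)
  ∷ jzero (reg 7) 17
  ∷ arith add (reg 4) (reg 4) (const 1)
  ∷ jump 9
  -- 17: a divisor has been found
  ∷ arith sub (reg 7) (reg 1) (reg 4)
  ∷ jzero (reg 7) 22
  ∷ copy (reg 1) (reg 4)
  ∷ copy (reg 0) (const 2)
  ∷ halt
  -- 22: N is prime
  ∷ copy (reg 0) (const 3)
  ∷ halt
  -- 24: no small divisors
  ∷ copy (reg 4) (const 2)
  -- 25: a new base
  ∷ copy (reg 5) (const 1)
  ∷ copy (reg 6) (reg 2)
  -- 27: baby steps
  ∷ jzero (reg 6) 36
  ∷ arith add (reg 7) (const 9) (reg 5)
  ∷ copy reg[ 7 ] (reg 4)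
  ∷ arith mul (reg 5) (reg 5) (reg 4)
  ∷ arith div (reg 7) (reg 5) (reg 1)
  ∷ arith mul (reg 7) (reg 7) (reg 1)
  ∷ arith sub (reg 5) (reg 5) (reg 7)
  ∷ arith sub (reg 6) (reg 6) (const 1)
  ∷ jump 27
  -- 36: register 5 is a ^ s
  ∷ copy (reg 8) (reg 5)
  ∷ copy (reg 6) (reg 2)
  -- 38: giant steps
  ∷ jzero (reg 6) 50
  ∷ arith add (reg 7) (const 9) (reg 5)
  ∷ arith sub (reg 7) (reg 4) reg[ 7 ]
  ∷ jzero (reg 7) 48
  ∷ arith mul (reg 5) (reg 5) (reg 8)
  ∷ arith div (reg 7) (reg 5) (reg 1)
  ∷ arith mul (reg 7) (reg 7) (reg 1)
  ∷ arith sub (reg 5) (reg 5) (reg 7)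
  ∷ arith sub (reg 6) (reg 6) (const 1)
  ∷ jump 38
  -- 48: a collision, so the order of a is small
  ∷ arith add (reg 4) (reg 4) (const 1)
  ∷ jump 25
  -- 50: no collision
  ∷ copy (reg 1) (reg 4)
  ∷ copy (reg 0) (const 1)
  ∷ halt
  ∷ []

program-literals : All (λ i → largestLiteral i ≤ 9) program
program-literals = from-yes (All.all? (λ i → largestLiteral i ≤? 9) program)

-- Memory layout, table updates and division

registers : (r₀ r₁ r₂ r₃ r₄ r₅ r₆ r₇ r₈ : ℕ) → (ℕ → ℕ) → Memory
registers r₀ r₁ r₂ r₃ r₄ r₅ r₆ r₇ r₈ T 0 = r₀
registers r₀ r₁ r₂ r₃ r₄ r₅ r₆ r₇ r₈ T 1 = r₁
registers r₀ r₁ r₂ r₃ r₄ r₅ r₆ r₇ r₈ T 2 = r₂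
registers r₀ r₁ r₂ r₃ r₄ r₅ r₆ r₇ r₈ T 3 = r₃
registers r₀ r₁ r₂ r₃ r₄ r₅ r₆ r₇ r₈ T 4 = r₄
registers r₀ r₁ r₂ r₃ r₄ r₅ r₆ r₇ r₈ T 5 = r₅
registers r₀ r₁ r₂ r₃ r₄ r₅ r₆ r₇ r₈ T 6 = r₆
registers r₀ r₁ r₂ r₃ r₄ r₅ r₆ r₇ r₈ T 7 = r₇
registers r₀ r₁ r₂ r₃ r₄ r₅ r₆ r₇ r₈ T 8 = r₈
registers r₀ r₁ r₂ r₃ r₄ r₅ r₆ r₇ r₈ T (suc (suc (suc (suc (suc (suc (suc (suc (suc y))))))))) = T y

≗-registers : ∀ {m r₀ r₁ r₂ r₃ r₄ r₅ r₆ r₇ r₈ T} →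
  m 0 ≡ r₀ → m 1 ≡ r₁ → m 2 ≡ r₂ → m 3 ≡ r₃ → m 4 ≡ r₄ → m 5 ≡ r₅ → m 6 ≡ r₆ →
  m 7 ≡ r₇ → m 8 ≡ r₈ → (∀ y → m (9 + y) ≡ T y) →
  m ≗ registers r₀ r₁ r₂ r₃ r₄ r₅ r₆ r₇ r₈ T
≗-registers e₀ e₁ e₂ e₃ e₄ e₅ e₆ e₇ e₈ e₉ = λ where
  0 → e₀
  1 → e₁
  2 → e₂
  3 → e₃
  4 → e₄
  5 → e₅
  6 → e₆
  7 → e₇
  8 → e₈
  (suc (suc (suc (suc (suc (suc (suc (suc (suc y))))))))) → e₉ y

extend-interval : ∀ {P : ℕ → Set} {l n} → (∀ i → l < i → i < n → P i) → P n →
                  ∀ i → l < i → i < suc n → P i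
extend-interval below p i l<i (s≤s i≤n) with m≤n⇒m<n∨m≡n i≤n
... | inj₁ i<n  = below i l<i i<n
... | inj₂ refl = p

update-same : ∀ T i v → (T [ i ↦ v ]) i ≡ v
update-same T i v with i ≡ᵇ i | ≡⇒≡ᵇ i i refl
... | true | _ = refl

update-cases : ∀ T i v j → (i ≡ j × (T [ i ↦ v ]) j ≡ v) ⊎ (T [ i ↦ v ]) j ≡ T j
update-cases T i v j with i ≡ᵇ j in eq
... | true  = inj₁ (≡ᵇ⇒≡ i j (subst Bool.T (sym eq) _) , refl)
... | false = inj₂ refl

apply-div : ∀ x n .{{_ : NonZero n}} → apply div x n ≡ x / n
apply-div x (suc n) = refl

div-remainder : ∀ x n .{{_ : NonZero n}} → x ∸ apply div x n * n ≡ x % n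
div-remainder x n = trans (cong (λ q → x ∸ q * n) (apply-div x n)) (sym (m%n≡m∸m/n*n x n))

div-*-≤ : ∀ {b} x n .{{_ : NonZero n}} → x ≤ b → apply div x n * n ≤ b
div-*-≤ x n x≤b = ≤-trans
  (≤-reflexive (cong (_* n) (apply-div x n))) (≤-trans (m/n*n≤m x n) x≤b)

-- A common divisor of `N` and `t` is at most `t`, so below `b`, and only 1 is left. The divisor 0
-- would force `N` to be 0.
no-divisor⇒coprime : ∀ {N b} → 1 < N → (∀ u → 1 < u → u < b → ¬ u ∣ N) →
                     ∀ t → 0 < t → t < b → Coprime N t
no-divisor⇒coprime 1<N none (suc t) _ t<b {zero} (0∣N , _) =
  contradiction (0∣⇒≡0 0∣N) λ { refl → contradiction 1<N λ () }
no-divisor⇒coprime 1<N none (suc t) _ t<b {suc zero} _ = refl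
no-divisor⇒coprime 1<N none (suc t) _ t<b {suc (suc u)} (u∣N , u∣t) =
  contradiction u∣N (none _ (s≤s z<s) (≤-trans (s≤s (∣⇒≤ u∣t)) t<b))

no-divisor⇒prime : ∀ {N} → 1 < N → (∀ u → 1 < u → u < N → ¬ u ∣ N) → Prime N
no-divisor⇒prime 1<N none = prime {{n>1⇒nonTrivial 1<N}}
  λ { (composite {d} d<N d∣N) → none d (nonTrivial⇒n>1 d) d<N d∣N }

-- Per base: 2 steps of set-up, `s` baby steps of 9 and a final test, 2 steps of set-up, `s` giant
-- steps of 10. The 6 pays for a giant step that collides and moves on to the next base; halting
-- without a collision takes 4.
searchSteps : ℕ → ℕ → ℕ
searchSteps s zero    = 0
searchSteps s (suc r) = 2 + (1 + (s * 9 + (2 + (6 + (s * 10 + searchSteps s r)))))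

searchSteps-≡ : ∀ s r → searchSteps s r ≡ r * (11 + 19 * s)
searchSteps-≡ s zero    = refl
searchSteps-≡ s (suc r) = trans
  (cong (λ n → 2 + (1 + (s * 9 + (2 + (6 + (s * 10 + n)))))) (searchSteps-≡ s r))
  (solve 2 (λ s m → con 2 :+ (con 1 :+ (s :* con 9 :+ (con 2 :+ (con 6 :+ (s :* con 10 :+ m)))))
              := con 11 :+ con 19 :* s :+ m) refl s (r * (11 + 19 * s)))
  where open +-*-Solver

-- A failed trial divisor takes 8 steps, one that yields a factor 11, and each candidate for the
-- root 5. Trial divisors and bases both range from 2 to `K² + 1`, hence the two occurrences of
-- `s⁴`.
stepsAfterRoot totalSteps : ℕ → ℕ
stepsAfterRoot s = 4 + (11 + (s * s * (s * s) * 8 + (1 + searchSteps s (s * s * (s * s)))))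
totalSteps s = s * 5 + stepsAfterRoot s

totalSteps-≤ : ∀ s → 0 < s → totalSteps s ≤ 59 * (s * s * (s * s) * s)
totalSteps-≤ s@(suc _) _ = begin
  totalSteps s
    ≡⟨ cong (λ n → s * 5 + (4 + (11 + (F * 8 + (1 + n))))) (searchSteps-≡ s F) ⟩
  s * 5 + (4 + (11 + (F * 8 + (1 + F * (11 + 19 * s)))))
    ≡⟨ solve 2 (λ s f → s :* con 5 :+ (con 4 :+ (con 11 :+ (f :* con 8 :+ (con 1 :+ f :* (con 11 :+ con 19 :* s)))))
              := con 5 :* s :+ con 16 :+ con 19 :* f :+ con 19 :* (f :* s)) refl s F ⟩
  5 * s + 16 + 19 * F + 19 * (F * s)
    -- Since `s > 0`, each monomial is at most `F * s`, and 5 + 16 + 19 + 19 = 59.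
    ≤⟨ +-monoˡ-≤ (19 * (F * s)) (+-mono-≤ (+-mono-≤ (*-monoʳ-≤ 5 (m≤n*m s F)) (*-monoʳ-≤ 16 (s≤s z≤n)))
                                          (*-monoʳ-≤ 19 (m≤m*n F s))) ⟩
  5 * (F * s) + 16 * (F * s) + 19 * (F * s) + 19 * (F * s)
    ≡⟨ solve 1 (λ q → con 5 :* q :+ con 16 :* q :+ con 19 :* q :+ con 19 :* q := con 59 :* q) refl (F * s) ⟩
  59 * (F * s) ∎
  where
  open ≤-Reasoning
  open +-*-Solver
  F = s * s * (s * s)

-- Analysis of the program for fixed `D` and `N`

module Search (D N s : ℕ) .{{_ : NonZero N}} (0<D : 0 < D) (D<N : D < N)
              (D≤s*s : D ≤ s * s) (s-least : ∀ {r} → r < s → r * r < D) where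

  -- `limit` is the first number past the trial divisors and the bases. `bound` is to dominate all
  -- registers: `K ≤ 4 D` gives `limit ≤ 18 N²`, and 32 rounds this up to a power of two, whose size
  -- is easy to compute.
  K limit bound : ℕ
  K     = s * s
  limit = K * K + 2
  bound = 32 * (N * N)

  1<N : 1 < N
  1<N = ≤-trans (s≤s 0<D) D<N

  0<s : 0 < s
  0<s = n≢0⇒n>0 λ s≡0 → ≤⇒≯ (subst (λ s → D ≤ s * s) s≡0 D≤s*s) 0<D

  instance
    s≢0 : NonZero s
    s≢0 = >-nonZero 0<s

  s≤K : s ≤ K
  s≤K = m≤m*n s s

  -- For `s = r + 2` minimality gives `(r + 1)² < D`, and `(r + 2)² ≤ 4 (r + 1)²`.
  K≤4D : K ≤ 4 * D
  K≤4D = least-square-≤ s 0<s s-least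
    where
    open +-*-Solver
    least-square-≤ : ∀ s → 0 < s → (∀ {r} → r < s → r * r < D) → s * s ≤ 4 * D
    least-square-≤ (suc zero)    _ _     = ≤-trans 0<D (m≤m+n D _)
    least-square-≤ (suc (suc r)) _ below = ≤-trans
      (≤-trans (m≤m+n _ (3 * (r * r) + 4 * r))
        (≤-reflexive (solve 1 (λ r → (con 2 :+ r) :* (con 2 :+ r) :+ (con 3 :* (r :* r) :+ con 4 :* r)
                                := con 4 :* ((con 1 :+ r) :* (con 1 :+ r))) refl r)))
      (*-monoʳ-≤ 4 (<⇒≤ (below ≤-refl)))

  N≤N*N : N ≤ N * N
  N≤N*N = m≤m*n N N

  N*N-≤bound : ∀ c → c ≤ 32 → c * (N * N) ≤ bound
  N*N-≤bound c = *-monoˡ-≤ (N * N)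

  1≤N*N : 1 ≤ N * N
  1≤N*N = ≤-trans (<⇒≤ 1<N) N≤N*N

  N≤bound : N ≤ bound
  N≤bound = ≤-trans N≤N*N (m≤m+n (N * N) _)

  literal-≤bound : ∀ {x} → x ≤ 9 → x ≤ bound
  literal-≤bound x≤9 = ≤-trans x≤9
    (≤-trans (*-monoʳ-≤ 9 1≤N*N) (N*N-≤bound 9 (m≤m+n 9 23)))

  K≤bound : K ≤ bound
  K≤bound = ≤-trans K≤4D (≤-trans (*-monoʳ-≤ 4 (≤-trans (<⇒≤ D<N) N≤N*N)) (N*N-≤bound 4 (m≤m+n 4 28)))

  limit≤bound : limit ≤ bound
  limit≤bound = ≤-trans
    (+-mono-≤ (*-mono-≤ (≤-trans K≤4D (*-monoʳ-≤ 4 (<⇒≤ D<N))) (≤-trans K≤4D (*-monoʳ-≤ 4 (<⇒≤ D<N))))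
              (*-monoʳ-≤ 2 1≤N*N))
    (≤-trans (≤-reflexive (solve 1 (λ n → con 4 :* n :* (con 4 :* n) :+ con 2 :* (n :* n)
                                    := con 18 :* (n :* n)) refl N))
      (N*N-≤bound 18 (m≤m+n 18 14)))
    where open +-*-Solver

  product-≤bound : ∀ {x y} → x < N → y < N → x * y ≤ bound
  product-≤bound x<N y<N =
    ≤-trans (*-mono-≤ (<⇒≤ x<N) (<⇒≤ y<N)) (m≤m+n (N * N) _)

  address-≤bound : ∀ {x} → x < N → 9 + x ≤ bound
  address-≤bound x<N = ≤-trans
    (+-mono-≤ (*-monoʳ-≤ 9 1≤N*N) (≤-trans (<⇒≤ x<N) N≤N*N))
    (≤-trans (≤-reflexive (+-comm (9 * (N * N)) (N * N))) (N*N-≤bound 10 (m≤m+n 10 22)))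

  open Execution program bound (All.map literal-≤bound program-literals) (Correct D N) public

  settle : ∀ {n pc m r₀ r₁ r₂ r₃ r₄ r₅ r₆ r₇ r₈ T} →
    m 0 ≡ r₀ → m 1 ≡ r₁ → m 2 ≡ r₂ → m 3 ≡ r₃ → m 4 ≡ r₄ → m 5 ≡ r₅ → m 6 ≡ r₆ →
    m 7 ≡ r₇ → m 8 ≡ r₈ → (∀ y → m (9 + y) ≡ T y) →
    Run n pc (registers r₀ r₁ r₂ r₃ r₄ r₅ r₆ r₇ r₈ T) → Run n pc m
  settle e₀ e₁ e₂ e₃ e₄ e₅ e₆ e₇ e₈ e₉ =
    run-cong (≗-registers e₀ e₁ e₂ e₃ e₄ e₅ e₆ e₇ e₈ e₉)

  searching : (a x c z g : ℕ) → (ℕ → ℕ) → Memory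
  searching = registers D N s limit

  -- The settled intermediate states keep the memory terms small: the
  -- nested updates would otherwise grow exponentially.
  run-multiply : ∀ {n a x c z g T y w l} pc →
    fetch program pc ≡ just (arith mul (reg 5) (reg 5) y) →
    fetch program (1 + pc) ≡ just (arith div (reg 7) (reg 5) (reg 1)) →
    fetch program (2 + pc) ≡ just (arith mul (reg 7) (reg 7) (reg 1)) →
    fetch program (3 + pc) ≡ just (arith sub (reg 5) (reg 5) (reg 7)) →
    fetch program (4 + pc) ≡ just (arith sub (reg 6) (reg 6) (const 1)) →
    fetch program (5 + pc) ≡ just (jump l) →
    value (searching a x (suc c) z g T) y ≡ w → x < N → w < N →
    Run n l (searching a (x * w % N) c (apply div (x * w) N * N) g T) →
    Run (6 + n) pc (searching a x (suc c) z g T)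
  run-multiply {n} {a} {x} {c} {z} {g} {T} {y} {w} {l} pc f₀ f₁ f₂ f₃ f₄ f₅ eq x<N w<N next =
    run-arith f₀ (≤-trans (≤-reflexive xy≡xw) xw≤)
      (settle refl refl refl refl refl xy≡xw refl refl refl (λ _ → refl) divide)
    where
    v = apply div (x * w) N
    xw≤ = product-≤bound x<N w<N
    xy≡xw = cong (x *_) eq
    count : Run (2 + n) (4 + pc) (searching a (x * w % N) (suc c) (v * N) g T)
    count = run-sub f₄ (settle refl refl refl refl refl refl refl refl refl (λ _ → refl)
      (run-jump f₅ next))
    subtract : Run (3 + n) (3 + pc) (searching a (x * w) (suc c) (v * N) g T)
    subtract = run-sub f₃
      (settle refl refl refl refl refl (div-remainder (x * w) N) refl refl refl (λ _ → refl) count)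
    multiply : Run (4 + n) (2 + pc) (searching a (x * w) (suc c) v g T)
    multiply = run-arith f₂ (div-*-≤ (x * w) N xw≤)
      (settle refl refl refl refl refl refl refl refl refl (λ _ → refl) subtract)
    divide : Run (5 + n) (1 + pc) (searching a (x * w) (suc c) z g T)
    divide = run-div f₁
      (settle refl refl refl refl refl refl refl refl refl (λ _ → refl) multiply)

  -- The table of baby steps

  SmallOrder : ℕ → Set
  SmallOrder a = ∃[ k ] 0 < k × k ≤ K × (a ^ k) ≡ 1 [mod N ]

  -- The table for base `a` after `j` baby steps. By `bounded`, the truncated difference `a ∸ T y`
  -- vanishes only if `T y ≡ a`, so the machine can test for equality by one subtraction.
  record Table (a j : ℕ) (T : ℕ → ℕ) : Set where
    field
      bounded  : ∀ y → T y ≤ a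
      sound    : ∀ y → T y ≡ a → ∃[ i ] i < j × y ≡ a ^ i % N
      complete : ∀ {i} → i < j → T (a ^ i % N) ≡ a

  open Table

  table-empty : ∀ {a T} → (∀ y → T y < a) → Table a 0 T
  table-empty below = record
    { bounded  = λ y → <⇒≤ (below y)
    ; sound    = λ y eq → contradiction eq (<⇒≢ (below y))
    ; complete = λ () }

  -- An earlier power with the same residue is overwritten by the same entry `a`, so `complete`
  -- survives.
  table-insert : ∀ {a j T} → Table a j T → Table a (suc j) (T [ a ^ j % N ↦ a ])
  table-insert {a} {j} {T} tab = record { bounded = bounded′ ; sound = sound′ ; complete = complete′ }
    where
    x = a ^ j % N
    bounded′ : ∀ y → (T [ x ↦ a ]) y ≤ a
    bounded′ y with update-cases T x a y
    ... | inj₁ (_ , eq) = ≤-reflexive eq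
    ... | inj₂ eq       = ≤-trans (≤-reflexive eq) (bounded tab y)
    sound′ : ∀ y → (T [ x ↦ a ]) y ≡ a → ∃[ i ] i < suc j × y ≡ a ^ i % N
    sound′ y hit with update-cases T x a y
    ... | inj₁ (x≡y , _) = j , ≤-refl , sym x≡y
    ... | inj₂ eq with i , i<j , y≡ ← sound tab y (trans (sym eq) hit) = i , m≤n⇒m≤1+n i<j , y≡
    complete′ : ∀ {i} → i < suc j → (T [ x ↦ a ]) (a ^ i % N) ≡ a
    complete′ {i} (s≤s i≤j) with update-cases T x a (a ^ i % N) | m≤n⇒m<n∨m≡n i≤j
    ... | inj₁ (_ , eq) | _         = eq
    ... | inj₂ eq       | inj₁ i<j  = trans eq (complete tab i<j)
    ... | inj₂ eq       | inj₂ refl = update-same T x a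

  -- The hit gives `a ^ (s * i) ≡ a ^ j` with `j < s ≤ s * i`, so the exponent `s * i ∸ j` is
  -- positive and at most `s * s`.
  collision⇒small-order : ∀ {a T i} → Coprime N a → Table a s T → 0 < i → i ≤ s →
    T (a ^ (s * i) % N) ≡ a → SmallOrder a
  collision⇒small-order {a} {T} {i} c tab 0<i i≤s hit
    with j , j<s , eq ← sound tab _ hit =
    s * i ∸ j , m<n⇒0<n∸m j<s*i , ≤-trans (m∸n≤m (s * i) j) (*-monoʳ-≤ s i≤s) ,
    power-cancel c j (s * i ∸ j)
      (trans (cong (λ e → a ^ e % N) (m+[n∸m]≡n (<⇒≤ j<s*i))) eq)
    where
    j<s*i : j < s * i
    j<s*i = ≤-trans j<s (m≤m*n s i {{>-nonZero 0<i}})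

  -- Dividing the predecessor of the exponent by `s` writes the exponent as `s * i ∸ j` with
  -- `0 < i ≤ s` and `j < s`. A power equal to 1 would then give `a ^ (s * i) ≡ a ^ j`, a collision.
  no-collision⇒large-order : ∀ {a T} → Table a s T →
    (∀ i → 0 < i → i ≤ s → T (a ^ (s * i) % N) ≢ a) →
    ∀ {k} → 0 < k → k ≤ K → ¬ (a ^ k) ≡ 1 [mod N ]
  no-collision⇒large-order {a} {T} tab miss {suc k} _ k<K d =
    miss (suc (k / s)) z<s (m<n*o⇒m/o<n k<K)
      (trans (cong T (trans (cong (λ e → a ^ e % N) (sym j+k≡s*i)) (power-shift j (suc k) d)))
             (complete tab (∸-monoʳ-< {s} z<s (m%n<n k s))))
    where
    j = s ∸ suc (k % s)
    open ≡-Reasoning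
    j+k≡s*i : j + suc k ≡ s * suc (k / s)
    j+k≡s*i = begin
      j + suc k                          ≡⟨ cong (λ k → j + suc k) (m≡m%n+[m/n]*n k s) ⟩
      j + (suc (k % s) + k / s * s)      ≡⟨ +-assoc j (suc (k % s)) (k / s * s) ⟨
      j + suc (k % s) + k / s * s        ≡⟨ cong (_+ k / s * s) (m∸n+n≡m (m%n<n k s)) ⟩
      s + k / s * s                      ≡⟨ *-comm (suc (k / s)) s ⟩
      s * suc (k / s)                    ∎

  -- The search through the bases

  module _ (coprime : ∀ t → 0 < t → t < limit → Coprime N t) (limit≤N : limit ≤ N) where

    -- Here and below r counts the remaining iterations, and the number of
    -- steps is written so that peeling off instructions is definitional.
    run-giant : ∀ {n} a T → 0 < a → a < limit → Table a s T → ∀ r i z → r + i ≡ suc s → 0 < i →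
      (∀ i′ → 0 < i′ → i′ < i → T (a ^ (s * i′) % N) ≢ a) →
      (∀ x c z → SmallOrder a → Run n 25 (searching (suc a) x c z (a ^ s % N) T)) →
      Run (6 + (r * 10 + n)) 38
        (searching a (a ^ (s * i) % N) r z (a ^ s % N) T)
    -- The counter is 0, so `i` is `suc s`: all `s` giant steps have missed.
    run-giant a T 0<a a<l tab zero i z eq 0<i miss next =
      run-jzero-taken refl refl
      (run-copy refl
      (run-copy refl
      (run-halt refl (λ e → trans (output-element (e 0)) (cong (λ v → just (element v)) (e 1)))
        (a<N , Coprime.sym c , proj₁ order , proj₂ order , D<order))))
      where
      a<N = ≤-trans a<l limit≤N
      c = coprime a 0<a a<l
      order = order-exists c
      D<order : D < proj₁ order
      D<order = ≰⇒> λ k≤D → no-collision⇒large-order tab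
        (λ i′ 0<i′ i′≤s → miss i′ 0<i′ (≤-trans (s≤s i′≤s) (≤-reflexive (sym eq))))
        (IsOrder.positive (proj₂ order)) (≤-trans k≤D D≤s*s) (IsOrder.power≡1 (proj₂ order))
    run-giant {n} a T 0<a a<l tab (suc r) i z eq 0<i miss next =
      run-jzero-skipped refl z<s
      (run-arith refl (address-≤bound x<N)
      (run-sub refl
      (settle refl refl refl refl refl refl refl refl refl (λ _ → refl) (branch (T x ≟ a)))))
      where
      x = a ^ (s * i) % N
      g = a ^ s % N
      x<N = m%n<n (a ^ (s * i)) N
      i≤s : i ≤ s
      i≤s = ≤-trans (m≤n+m i r) (≤-reflexive (suc-injective eq))
      next-power : x * g % N ≡ a ^ (s * suc i) % N
      next-power = begin
        x * g % N                        ≡⟨ %-distribˡ-* (a ^ (s * i)) (a ^ s) N ⟨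
        a ^ (s * i) * a ^ s % N          ≡⟨ cong (_% N) (^-distribˡ-+-* a (s * i) s) ⟨
        a ^ (s * i + s) % N              ≡⟨ cong (λ e → a ^ e % N)
                                              (trans (+-comm (s * i) s) (sym (*-suc s i))) ⟩
        a ^ (s * suc i) % N              ∎
        where open ≡-Reasoning
      branch : Dec (T x ≡ a) →
        Run (13 + (r * 10 + n)) 41 (searching a x (suc r) (a ∸ T x) g T)
      branch (yes hit) =
        run-jzero-taken refl (m≤n⇒m∸n≡0 (≤-reflexive (sym hit)))
        (run-arith refl (≤-trans (≤-reflexive (+-comm a 1)) (≤-trans a<l limit≤bound))
        (run-jump refl
        (settle refl refl refl refl (+-comm a 1) refl refl refl refl (λ _ → refl)
        -- The steps reserved for the remaining giant steps are forfeited.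
        (run-mono (m≤n+m n (suc r * 10))
        (next _ _ _ (collision⇒small-order (coprime a 0<a a<l) tab 0<i i≤s hit))))))
      branch (no miss-i) =
        -- An entry other than `a` is below `a`, so the truncated difference is positive.
        run-jzero-skipped refl (m<n⇒0<n∸m (≤∧≢⇒< (bounded tab x) miss-i))
        (run-multiply 42 refl refl refl refl refl refl refl x<N (m%n<n (a ^ s) N)
        (settle refl refl refl refl refl next-power refl refl refl (λ _ → refl)
        (run-giant a T 0<a a<l tab r (suc i) _ (trans (+-suc r i) eq) z<s (extend-interval miss miss-i) next)))

    -- The rest of the run enters as the continuation `next`, so that the step counts of consecutive
    -- loops add up.
    run-baby : ∀ {n} a → a < limit → ∀ r j T z g → r + j ≡ s → Table a j T →
      (∀ T z → Table a s T → Run n 36 (searching a (a ^ s % N) 0 z g T)) →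
      Run (1 + (r * 9 + n)) 27 (searching a (a ^ j % N) r z g T)
    run-baby a a<l zero j T z g refl tab next = run-jzero-taken refl refl (next T z tab)
    run-baby a a<l (suc r) j T z g eq tab next =
      run-jzero-skipped refl z<s
      (run-arith refl (address-≤bound x<N)
      (run-copy refl
      (settle refl refl refl refl refl refl refl refl refl (λ _ → refl)
      (run-multiply 30 refl refl refl refl refl refl refl x<N (≤-trans a<l limit≤N)
      (settle refl refl refl refl refl next-power refl refl refl (λ _ → refl)
      (run-baby a a<l r (suc j) (T [ x ↦ a ]) _ g (trans (+-suc r j) eq) (table-insert tab) next))))))
      where
      x = a ^ j % N
      x<N = m%n<n (a ^ j) N
      next-power : x * a % N ≡ a ^ suc j % N
      next-power = trans ([m%n*o]%n≡m*o%n (a ^ j) a N) (cong (_% N) (*-comm (a ^ j) a))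

    run-search : ∀ r a T x c z g → 1 < a → r + a ≡ limit → (∀ y → T y < a) →
      (∀ b → 0 < b → b < a → SmallOrder b) →
      Run (searchSteps s r) 25 (searching a x c z g T)
    -- No base is left, so `1, …, K² + 1` all have small order, which is impossible; this case
    -- executes nothing.
    run-search zero    a T x c z g 1<a refl below small = contradiction
      (λ b 0<b b≤1+KK → small b 0<b (≤-trans (s≤s b≤1+KK) (≤-reflexive (+-comm 2 (K * K)))))
      (not-all-orders-bounded K 1<N
        λ t 0<t t≤KK → coprime t 0<t (≤-trans (s≤s t≤KK)
          (≤-trans (n≤1+n _) (≤-reflexive (+-comm 2 (K * K))))))
    run-search (suc r) a T x c z g 1<a eq below small =
      run-copy refl
      (run-copy refl
      -- Register 5 starts as 1, which is `a ^ 0 % N` because `1 < N`.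
      (settle refl refl refl refl refl (sym (m<n⇒m%n≡m 1<N)) refl refl refl (λ _ → refl)
      (run-baby a a<l s 0 T z g (+-identityʳ s) (table-empty below) λ T z tab →
      run-copy refl
      (run-copy refl
      (settle refl refl refl refl refl (cong (λ e → a ^ e % N) (sym (*-identityʳ s)))
        refl refl refl (λ _ → refl)
      (run-giant a T 0<a a<l tab s 1 z (+-comm s 1) z<s (λ _ 0<i i<1 → contradiction 0<i (<⇒≱ i<1))
      λ x c z small-a →
      run-search r (suc a) T x c z _ (m≤n⇒m≤1+n 1<a) (trans (+-suc r a) eq)
        -- Entries are at most `a`, hence stale for the base `suc a`.
        (λ y → s≤s (bounded tab y))
        (extend-interval small small-a)))))))
      where
      0<a = <⇒≤ 1<a
      a<l : a < limit
      a<l = ≤-trans (s≤s (m≤n+m a r)) (≤-reflexive eq)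

  -- Trial division, the square root and the whole run

  zeros : ℕ → ℕ
  zeros _ = 0

  -- If `N < limit`, the loop stops at `t = N` at the latest; reaching `N` means that it has no
  -- smaller divisor above 1 and is prime.
  run-trial : ∀ {n} r t z → 1 < t → r + t ≡ limit → (∀ u → 1 < u → u < t → ¬ u ∣ N) →
    (∀ z → (∀ u → 1 < u → u < limit → ¬ u ∣ N) →
       Run n 24 (registers D N s limit limit 0 0 z 0 zeros)) →
    Run (11 + (r * 8 + n)) 9 (registers D N s limit t 0 0 z 0 zeros)
  run-trial {n} zero t z 1<t refl none next =
    run-sub refl
    (run-jzero-taken refl (n∸n≡0 limit)
    (run-mono (m≤n+m n 9)
    (settle refl refl refl refl refl refl refl refl refl (λ _ → refl) (next _ none))))
  run-trial {n} (suc r) t z 1<t eq none next =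
    run-sub refl
    (run-jzero-skipped refl (m<n⇒0<n∸m t<limit)
    (run-div refl
    (run-arith refl (div-*-≤ N t N≤bound)
    (run-sub refl
    (settle refl refl refl refl refl refl refl (div-remainder N t) refl (λ _ → refl)
    (branch (t ∣? N)))))))
    where
    instance
      t≢0 : NonZero t
      t≢0 = >-nonZero (<⇒≤ 1<t)
    t<limit : t < limit
    t<limit = ≤-trans (s≤s (m≤n+m t r)) (≤-reflexive eq)
    divisor : t ∣ N → Dec (t ≡ N) →
      Run (4 + (1 + (suc r * 8 + n))) 17 (registers D N s limit t 0 0 (N % t) 0 zeros)
    divisor t∣N (yes t≡N) =
      run-sub refl
      (run-jzero-taken refl (m≤n⇒m∸n≡0 (≤-reflexive (sym t≡N)))
      (run-copy refl
      (run-halt refl (λ e → output-prime (e 0))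
        (no-divisor⇒prime 1<N λ u 1<u u<N → none u 1<u (≤-trans u<N (≤-reflexive (sym t≡N)))))))
    divisor t∣N (no t≢N) =
      run-sub refl
      (run-jzero-skipped refl (m<n⇒0<n∸m t<N)
      (run-copy refl
      (run-copy refl
      (run-halt refl (λ e → trans (output-factor (e 0)) (cong (λ v → just (factor v)) (e 1)))
        (1<t , t<N , t∣N)))))
      where
      t<N : t < N
      t<N = ≤∧≢⇒< (∣⇒≤ t∣N) t≢N
    branch : Dec (t ∣ N) →
      Run (6 + (suc r * 8 + n)) 14 (registers D N s limit t 0 0 (N % t) 0 zeros)
    branch (yes t∣N) = run-jzero-taken refl (n∣m⇒m%n≡0 N t t∣N) (divisor t∣N (t ≟ N))
    branch (no t∤N)  =
      run-jzero-skipped refl (n≢0⇒n>0 λ z → t∤N (m%n≡0⇒n∣m N t z))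
      (run-arith refl (≤-trans (≤-reflexive (+-comm t 1)) (≤-trans t<limit limit≤bound))
      (run-jump refl
      (settle refl refl refl refl (+-comm t 1) refl refl refl refl (λ _ → refl)
      (run-trial r (suc t) _ (m≤n⇒m≤1+n 1<t) (trans (+-suc r t) eq) (extend-interval none t∤N) next))))

  -- Register 2 is incremented before it is tested, so `suc r` iterations remain when it holds `i`.
  run-root : ∀ {n} r i z → suc r + i ≡ s →
    (∀ z → Run n 5 (registers D N s 0 0 0 0 z 0 zeros)) →
    Run (suc r * 5 + n) 0 (registers D N i 0 0 0 0 z 0 zeros)
  run-root {n} r i z eq next =
    run-arith refl (≤-trans (≤-reflexive (+-comm i 1)) (≤-trans i<s (≤-trans s≤K K≤bound)))
    (settle refl refl (+-comm i 1) refl refl refl refl refl refl (λ _ → refl)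
    (run-arith refl (≤-trans (*-mono-≤ i<s i<s) K≤bound)
    (run-sub refl
    (settle refl refl refl refl refl refl refl refl refl (λ _ → refl)
    (branch r eq)))))
    where
    i<s : i < s
    i<s = ≤-trans (s≤s (m≤n+m i r)) (≤-reflexive eq)
    branch : ∀ r → suc r + i ≡ s →
      Run (2 + (r * 5 + n)) 3 (registers D N (suc i) 0 0 0 0 (D ∸ suc i * suc i) 0 zeros)
    branch zero eq =
      run-jzero-taken refl (m≤n⇒m∸n≡0 (subst (λ j → D ≤ j * j) (sym eq) D≤s*s))
      -- The last iteration leaves without the jump back, one step short of the 5 allotted.
      (run-mono (n≤1+n n)
      (settle refl refl eq refl refl refl refl refl refl (λ _ → refl) (next _)))
    branch (suc r) eq =
      run-jzero-skipped refl (m<n⇒0<n∸m (s-least (≤-trans (s≤s (s≤s (m≤n+m i r))) (≤-reflexive eq))))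
      (run-jump refl (run-root r (suc i) _ (trans (cong suc (+-suc r i)) eq) next))

  run-after-root : ∀ z → Run (stepsAfterRoot s) 5 (registers D N s 0 0 0 0 z 0 zeros)
  run-after-root z =
    run-arith refl K≤bound
    (settle refl refl refl refl refl refl refl refl refl (λ _ → refl)
    (run-arith refl (≤-trans (m≤m+n (K * K) 2) limit≤bound)
    (run-arith refl limit≤bound
    (run-copy refl
    (settle refl refl refl refl refl refl refl refl refl (λ _ → refl)
    (run-trial (K * K) 2 z ≤-refl refl (λ u 1<u u<2 → contradiction 1<u (<⇒≱ u<2)) λ z none →
    run-copy refl
    (settle refl refl refl refl refl refl refl refl refl (λ _ → refl)
    (run-search (no-divisor⇒coprime 1<N none) (limit≤N none) (K * K) 2 zeros 0 0 z 0
      ≤-refl refl (λ _ → z<s) small))))))))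
    where
    limit≤N : (∀ u → 1 < u → u < limit → ¬ u ∣ N) → limit ≤ N
    -- Otherwise `N` itself would have been a trial divisor of `N`.
    limit≤N none = ≮⇒≥ λ N<limit → none N 1<N N<limit ∣-refl
    small : ∀ b → 0 < b → b < 2 → SmallOrder b
    -- The search starts at the base 2, but the roots are counted from 1, whose order is 1.
    small (suc zero) _ _ = 1 , z<s , ≤-trans 0<s s≤K , N ∣0
    small (suc (suc b)) _ (s≤s (s≤s ()))

  run-program : Run (totalSteps s) 0 (registers D N 0 0 0 0 0 0 0 zeros)
  run-program = subst (λ r → Run (r * 5 + stepsAfterRoot s) 0 (registers D N 0 0 0 0 0 0 0 zeros))
    (suc-pred s)
    (run-root (pred s) 0 0 (trans (+-identityʳ _) (suc-pred s)) run-after-root)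

-- The running time

least-square : ∀ D → ∃[ s ] D ≤ s * s × (∀ {r} → r < s → r * r < D)
least-square D with least (λ s → D ≤? s * s) D (D≤D*D D)
  where
  D≤D*D : ∀ D → D ≤ D * D
  D≤D*D zero      = z≤n
  D≤D*D D@(suc _) = m≤m*n D D
... | s , D≤s*s , below = s , D≤s*s , λ r<s → ≰⇒> (below r<s)

-- If `suc k` is the least exponent with `n < 2 ^ suc k`, then `2 ^ k ≤ n`, and taking logarithms
-- gives `k ≤ ⌊log₂ n ⌋`.
n<2^1+log₂n : ∀ n → 0 < n → n < 2 ^ suc ⌊log₂ n ⌋
n<2^1+log₂n n 0<n with least (λ k → n <? 2 ^ k) n (n<2^n n)
  where
  n<2^n : ∀ n → n < 2 ^ n
  n<2^n zero    = z<s
  n<2^n (suc n) = +-mono-≤ (m^n>0 2 n) (≤-trans (n<2^n n) (m≤m+n (2 ^ n) 0))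
... | zero  , n<1 , _     = contradiction 0<n (<⇒≱ n<1)
... | suc k , n<  , below = ≤-trans n< (^-monoʳ-≤ 2 (s≤s
  (≤-trans (≤-reflexive (sym (⌊log₂[2^n]⌋≡n k))) (⌊log₂⌋-mono-≤ (≮⇒≥ (below ≤-refl))))))

-- As `N < 2 ^ suc L`, the number `32 N²` is at most `2 ^ (2 L + 7)` and has size at most
-- `2 L + 8 ≤ 10 L`. Then 11 · 10 + 10 · 10 = 210.
stepCost-≤ : ∀ N → 1 < N → stepCost (32 * (N * N)) ≤ 210 * (⌊log₂ N ⌋ * ⌊log₂ N ⌋)
stepCost-≤ N 1<N = begin
  11 * S + S * S                          ≤⟨ +-mono-≤ (*-monoʳ-≤ 11 S≤10L) (*-mono-≤ S≤10L S≤10L) ⟩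
  11 * (10 * L) + 10 * L * (10 * L)       ≤⟨ +-monoˡ-≤ (10 * L * (10 * L)) (*-monoʳ-≤ 11 (*-monoʳ-≤ 10 L≤L*L)) ⟩
  11 * (10 * (L * L)) + 10 * L * (10 * L) ≡⟨ solve 1 (λ l → con 11 :* (con 10 :* (l :* l)) :+ con 10 :* l :* (con 10 :* l)
                                                       := con 210 :* (l :* l)) refl L ⟩
  210 * (L * L)                           ∎
  where
  open ≤-Reasoning
  open +-*-Solver
  L = ⌊log₂ N ⌋
  S = size (32 * (N * N))
  1≤L : 1 ≤ L
  1≤L = ⌊log₂⌋-mono-≤ 1<N
  L≤L*L : L ≤ L * L
  L≤L*L = m≤m*n L L {{>-nonZero 1≤L}}
  N≤ : N ≤ 2 ^ suc L
  N≤ = <⇒≤ (n<2^1+log₂n N (<⇒≤ 1<N))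
  S≤10L : S ≤ 10 * L
  S≤10L = begin
    S                                       ≤⟨ s≤s (⌊log₂⌋-mono-≤ (*-monoʳ-≤ 32 (*-mono-≤ N≤ N≤))) ⟩
    size (2 ^ 5 * (2 ^ suc L * 2 ^ suc L))  ≡⟨ cong (λ p → size (2 ^ 5 * p)) (^-distribˡ-+-* 2 (suc L) (suc L)) ⟨
    size (2 ^ 5 * 2 ^ (suc L + suc L))      ≡⟨ cong size (^-distribˡ-+-* 2 5 (suc L + suc L)) ⟨
    size (2 ^ (5 + (suc L + suc L)))        ≡⟨ cong suc (⌊log₂[2^n]⌋≡n (5 + (suc L + suc L))) ⟩
    6 + (suc L + suc L)                     ≡⟨ solve 1 (λ l → con 6 :+ ((con 1 :+ l) :+ (con 1 :+ l)) := con 8 :+ con 2 :* l) refl L ⟩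
    8 + 2 * L                               ≤⟨ +-monoˡ-≤ (2 * L) (*-monoʳ-≤ 8 1≤L) ⟩
    8 * L + 2 * L                           ≡⟨ *-distribʳ-+ L 8 2 ⟨
    10 * L                                  ∎

-- The exponent 5/2 has denominator 2, so both sides are squared: `s¹⁰ = (s²)⁵ ≤ (4 D)⁵`, and
-- `4⁵ = 32²` accounts for the constant 32.
within-bound : ∀ A B {D N s t} → s * s ≤ 4 * D →
  t ≤ A * (s * s * (s * s) * s) * (B * (⌊log₂ N ⌋ * ⌊log₂ N ⌋)) →
  WithinBound (32 * (A * B)) 2 (λ _ → 0ℚ) D N t
within-bound A B {D} {N} {s} {t} s*s≤4D t≤ = begin
  t ^ 2 * 1
    ≤⟨ *-monoˡ-≤ 1 (^-monoˡ-≤ 2 t≤) ⟩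
  (A * (s * s * (s * s) * s) * (B * (L * L))) ^ 2 * 1
    ≡⟨ solve 4 (λ a b s l → (a :* (s :* s :* (s :* s) :* s) :* (b :* (l :* l))) :^ 2 :* con 1
                  := (a :* b :* l :^ 2) :^ 2 :* ((s :* s) :^ 5)) refl A B s L ⟩
  (A * B * L ^ 2) ^ 2 * (s * s) ^ 5
    ≤⟨ *-monoʳ-≤ ((A * B * L ^ 2) ^ 2) (^-monoˡ-≤ 5 s*s≤4D) ⟩
  (A * B * L ^ 2) ^ 2 * (4 * D) ^ 5
    ≡⟨ solve 3 (λ c l d → (c :* l :^ 2) :^ 2 :* ((con 4 :* d) :^ 5)
                  := (con 32 :* c :* l :^ 2) :^ 2 :* d :^ 5) refl (A * B) L D ⟩
  (32 * (A * B) * L ^ 2) ^ 2 * D ^ 5 ∎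
  where
  open ≤-Reasoning
  open +-*-Solver
  L = ⌊log₂ N ⌋

zero-tends-to-zero : TendsToZero (λ _ → 0ℚ)
zero-tends-to-zero δ 0<δ = 0 , λ D _ → 0<δ

module _ {D N s : ℕ} (0<D : 0 < D) (D<N : D < N)
         (D≤s*s : D ≤ s * s) (s-least : ∀ {r} → r < s → r * r < D) where

  private
    instance
      N≢0 : NonZero N
      N≢0 = >-nonZero (≤-trans (s≤s z≤n) D<N)

  open Search D N s 0<D D<N D≤s*s s-least

  initial-bounded : BoundedBy bound (State.mem (initial D N))
  initial-bounded 0 = ≤-trans (<⇒≤ D<N) N≤bound
  initial-bounded 1 = N≤bound
  initial-bounded (suc (suc _)) = z≤n

  program-halts : Halts (totalSteps s) (initial D N)
  program-halts = Run.run run-program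
    (≗-registers refl refl refl refl refl refl refl refl refl (λ _ → refl)) initial-bounded

  program-correct : ∃[ m ] ∃[ t ] ∃[ o ]
    program ⊢ initial D N ⇓ m [ t ] × output m ≡ just o ×
    Correct D N o × WithinBound (32 * (59 * 210)) 2 (λ _ → 0ℚ) D N t
  program-correct = result , time , verdict , halts , outputs , good ,
    within-bound 59 210 {D} {N} {s} K≤4D
      (≤-trans time-≤ (*-mono-≤ (totalSteps-≤ s 0<s) (stepCost-≤ N 1<N)))
    where open Halts program-halts

proposition1p2 : ∃[ P ] ∃[ C ] ∃[ c ] ∃[ ε ]
    0 < C × 0 < c × TendsToZero ε ×
    (∀ (D N : ℕ) → 0 < D → D < N →
    ∃[ m ] ∃[ t ] ∃[ o ]
    P ⊢ initial D N ⇓ m [ t ] × output m ≡ just o ×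
    Correct D N o × WithinBound C c ε D N t)
proposition1p2 = program , 32 * (59 * 210) , 2 , (λ _ → 0ℚ) , z<s , z<s , zero-tends-to-zero ,
  λ D N 0<D D<N → let s , D≤s*s , s-least = least-square D in
    program-correct 0<D D<N D≤s*s s-least
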